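{- For all proof keyed labels $\theta_1$, $\theta_2$: 1. If $\theta_1$ and $\theta_2$ are independent then $\theta_1$ and $\theta_2$ are connected. 2. If $\theta_1$ and $\theta_2$ are dependent then $\theta_1$ and $\theta_2$ are connected. 3. If $\theta_1$ and $\theta_2$ are connected then either $\theta_1$ and $\theta_2$ are independent or $\theta_1$ and $\theta_2$ are dependent, but not both.
   Context: Setting: CCSK (reversible CCS with communication keys) enriched with proof labels. Labels $\alpha$ range over names $a$, co-names $\overline{a}$ and $\tau$ ($\overline{\tau}=\tau$); $\lambda$ ranges over labels other than $\tau$; $k, m, n$ range over a denumerable set of keys. Let $d$ range over directions $L, R$, with $\overline{d}$ the opposite direction, and $\upsilon, \upsilon_1, \upsilon_2$ range over strings in $\{\mid_L, \mid_R, +_L, +_R\}^*$. Proof keyed labels are $\theta ::= \upsilon\,\alpha[k] \;|\; \upsilon\,\langle \upsilon_1 \lambda[k], \upsilon_2 \overline{\lambda}[k]\rangle$; the key of $\upsilon\alpha[k]$ and of $\upsilon\langle\upsilon_1\lambda[k],\upsilon_2\overline{\lambda}[k]\rangle$ is $k$. A label of the form $\alpha[k]$ (empty string $\upsilon$) is called a prefix. In a synchronisation label $\langle\theta_L,\theta_R\rangle$, $\theta_d$ denotes the component on side $d$. Three binary relations on proof keyed labels are defined as the relations derivable by the following rules. Connectivity ($\theta_1$ and $\theta_2$ are connected): A1: $\alpha[k]$ is connected to any $\theta$. A2: $\theta$ is connected to $\alpha[k]$ if $\theta$ is not a prefix. P1: $\mid_d\theta$ connected to $\mid_d\theta'$ if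 $\theta$ connected to $\theta'$. P2: $\mid_d\theta$ connected to $\mid_{\overline d}\theta'$ (always). C1: $+_d\theta$ connected to $+_d\theta'$ if $\theta$ connected to $\theta'$. C2: $+_d\theta$ connected to $+_{\overline d}\theta'$ (always). S1: $\mid_d\theta$ connected to $\langle\theta_L,\theta_R\rangle$ if $\theta$ connected to $\theta_d$. S2: $\langle\theta_L,\theta_R\rangle$ connected to $\mid_d\theta$ if $\theta_d$ connected to $\theta$. S3: $\langle\theta_1,\theta_2\rangle$ connected to $\langle\theta'_1,\theta'_2\rangle$ if $\theta_1$ connected to $\theta'_1$ and $\theta_2$ connected to $\theta'_2$. Dependence ($\theta_1$ and $\theta_2$ are dependent): A1: $\alpha[k]$ dependent on any $\theta$. A2: $\theta$ dependent on $\alpha[k]$ if $\theta$ is not a prefix. C1: $+_d\theta$ dependent on $+_d\theta'$ if $\theta$ dependent on $\theta'$. C2: $+_d\theta$ dependent on $+_{\overline d}\theta'$ (always). P1: $\mid_d\theta$ dependent on $\mid_d\theta'$ if $\theta$ dependent on $\theta'$. P2$_k$: $\mid_d\theta$ dependent on $\mid_{\overline d}\theta'$ if the key of $\theta$ equals the key of $\theta'$. S1: $\mid_d\theta$ dependent on $\langle\theta_L,\theta_R\rangle$ if $\theta$ dependent on $\theta_d$. S2: $\langle\theta_L,\theta_R\rangle$ dependent on $\mid_d\theta$ if $\theta_d$ dependent on $\theta$. S3: $\langle\theta_1,\theta_2\rangle$ dependent on $\langle\theta'_1,\theta'_2\rangle$ if, for some $i \neq j$ in $\{1,2\}$, $\theta_i$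 is dependent on $\theta'_i$ and $\theta_j$ is connected to $\theta'_j$. Independence ($\theta_1$ and $\theta_2$ are independent): no rule for prefixes. C1: $+_d\theta$ independent of $+_d\theta'$ if $\theta$ independent of $\theta'$ (no rule for $+_d$ vs $+_{\overline d}$). P1: $\mid_d\theta$ independent of $\mid_d\theta'$ if $\theta$ independent of $\theta'$. P2$_k$: $\mid_d\theta$ independent of $\mid_{\overline d}\theta'$ if the key of $\theta$ differs from the key of $\theta'$. S1: $\mid_d\theta$ independent of $\langle\theta_L,\theta_R\rangle$ if $\theta$ independent of $\theta_d$. S2: $\langle\theta_L,\theta_R\rangle$ independent of $\mid_d\theta$ if $\theta_d$ independent of $\theta$. S3: $\langle\theta_1,\theta_2\rangle$ independent of $\langle\theta'_1,\theta'_2\rangle$ if $\theta_1$ independent of $\theta'_1$ and $\theta_2$ independent of $\theta'_2$. -}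

module Defs where

open import Data.List.Base using (List; foldr)
open import Relation.Binary.PropositionalEquality using (_≡_; _≢_)
open import Relation.Nullary.Negation using (¬_)

data Dir : Set where
  L R : Dir

opposite : Dir → Dir
opposite L = R
opposite R = L

data Op : Set where
  ∣[_] : Dir → Op
  +[_] : Dir → Op

module ProofLabels (Name Key : Set) where

  -- The labels λ other than τ.
  data Visible : Set where
    name   : Name → Visible
    coname : Name → Visible

  co : Visible → Visible
  co (name a)   = coname a
  co (coname a) = name a

  data Label : Set where
    vis : Visible → Label
    τ   : Label

  -- The data υ₁, υ₂, λ, k of ⟨ υ₁ λ[k] , υ₂ λ̄[k] ⟩, with υ₁ = υL and υ₂ = υR;
  -- λ is a reserved symbol, hence ƛ.
  record Sync : Set where
    constructor sync
    field
      υL υR : List Op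
      ƛ     : Visible
      k     : Key

  infix  8 _[_]
  infixr 6 _∷_

  -- The leading string υ is built one symbol at a time by _∷_.  It can be
  -- put in front of either form, but ⟨_⟩ cannot be nested.
  data ProofKeyedLabel : Set where
    _[_] : Label → Key → ProofKeyedLabel
    ⟨_⟩  : Sync → ProofKeyedLabel
    _∷_  : Op → ProofKeyedLabel → ProofKeyedLabel

  key : ProofKeyedLabel → Key
  key (α [ k ]) = k
  key ⟨ s ⟩     = Sync.k s
  key (o ∷ θ)   = key θ

  data IsPrefix : ProofKeyedLabel → Set where
    prefix : ∀ {α k} → IsPrefix (α [ k ])

  -- θ_d for the synchronisation label ⟨θ_L , θ_R⟩.
  component : Dir → Sync → ProofKeyedLabel
  component L (sync υL υR ƛ k) = foldr _∷_ (vis ƛ [ k ]) υL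
  component R (sync υL υR ƛ k) = foldr _∷_ (vis (co ƛ) [ k ]) υR

  data Connected : ProofKeyedLabel → ProofKeyedLabel → Set where
    A1 : ∀ {α k θ} → Connected (α [ k ]) θ
    A2 : ∀ {α k θ} → ¬ IsPrefix θ → Connected θ (α [ k ])
    P1 : ∀ {d θ θ′} → Connected θ θ′ →
         Connected (∣[ d ] ∷ θ) (∣[ d ] ∷ θ′)
    P2 : ∀ {d d̄ θ θ′} → d̄ ≡ opposite d →
         Connected (∣[ d ] ∷ θ) (∣[ d̄ ] ∷ θ′)
    C1 : ∀ {d θ θ′} → Connected θ θ′ →
         Connected (+[ d ] ∷ θ) (+[ d ] ∷ θ′)
    C2 : ∀ {d d̄ θ θ′} → d̄ ≡ opposite d →
         Connected (+[ d ] ∷ θ) (+[ d̄ ] ∷ θ′)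
    S1 : ∀ {d θ s} → Connected θ (component d s) →
         Connected (∣[ d ] ∷ θ) ⟨ s ⟩
    S2 : ∀ {d θ s} → Connected (component d s) θ →
         Connected ⟨ s ⟩ (∣[ d ] ∷ θ)
    S3 : ∀ {s s′} →
         Connected (component L s) (component L s′) →
         Connected (component R s) (component R s′) →
         Connected ⟨ s ⟩ ⟨ s′ ⟩

  data Dependent : ProofKeyedLabel → ProofKeyedLabel → Set where
    A1  : ∀ {α k θ} → Dependent (α [ k ]) θ
    A2  : ∀ {α k θ} → ¬ IsPrefix θ → Dependent θ (α [ k ])
    C1  : ∀ {d θ θ′} → Dependent θ θ′ →
          Dependent (+[ d ] ∷ θ) (+[ d ] ∷ θ′)
    C2  : ∀ {d d̄ θ θ′} → d̄ ≡ opposite d →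
          Dependent (+[ d ] ∷ θ) (+[ d̄ ] ∷ θ′)
    P1  : ∀ {d θ θ′} → Dependent θ θ′ →
          Dependent (∣[ d ] ∷ θ) (∣[ d ] ∷ θ′)
    P2ₖ : ∀ {d d̄ θ θ′} → d̄ ≡ opposite d → key θ ≡ key θ′ →
          Dependent (∣[ d ] ∷ θ) (∣[ d̄ ] ∷ θ′)
    S1  : ∀ {d θ s} → Dependent θ (component d s) →
          Dependent (∣[ d ] ∷ θ) ⟨ s ⟩
    S2  : ∀ {d θ s} → Dependent (component d s) θ →
          Dependent ⟨ s ⟩ (∣[ d ] ∷ θ)
    S3  : ∀ {s s′} (i j : Dir) → i ≢ j →
          Dependent (component i s) (component i s′) →
          Connected (component j s) (component j s′) →
          Dependent ⟨ s ⟩ ⟨ s′ ⟩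

  data Independent : ProofKeyedLabel → ProofKeyedLabel → Set where
    C1  : ∀ {d θ θ′} → Independent θ θ′ →
          Independent (+[ d ] ∷ θ) (+[ d ] ∷ θ′)
    P1  : ∀ {d θ θ′} → Independent θ θ′ →
          Independent (∣[ d ] ∷ θ) (∣[ d ] ∷ θ′)
    P2ₖ : ∀ {d d̄ θ θ′} → d̄ ≡ opposite d → key θ ≢ key θ′ →
          Independent (∣[ d ] ∷ θ) (∣[ d̄ ] ∷ θ′)
    S1  : ∀ {d θ s} → Independent θ (component d s) →
          Independent (∣[ d ] ∷ θ) ⟨ s ⟩
    S2  : ∀ {d θ s} → Independent (component d s) θ →
          Independent ⟨ s ⟩ (∣[ d ] ∷ θ)
    S3  : ∀ {s s′} →
          Independent (component L s) (component L s′) →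
          Independent (component R s) (component R s′) →
          Independent ⟨ s ⟩ ⟨ s′ ⟩

{-# OPTIONS --safe #-}
module Submission where

open import Data.Empty using (⊥)
open import Data.Nat.Base using (ℕ)
open import Data.Nat.Properties using () renaming (_≟_ to _≟ℕ_)
open import Data.Product.Base using (_×_; _,_; uncurry)
open import Data.Sum.Base using (_⊎_; inj₁; inj₂) renaming (map to map-⊎)
open import Function.Bundles using (_↔_)
open import Function.Properties.Inverse using (↔⇒↣)
open import Relation.Binary.Definitions using (DecidableEquality)
open import Relation.Binary.PropositionalEquality using (_≢_; refl)
open import Relation.Nullary.Decidable using (yes; no; via-injection)
open import Relation.Nullary.Negation using (¬_; contradiction)
open import Defs

-- Independence and dependence divide connectivity between them, rule by rule. Prefixes and opposite
-- choices are always dependent; opposite sides of a parallel split on whether the keys agree; the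
-- other one-premise rules transmit the verdict of their premise. For two synchronisations,
-- independence asks for it on both sides, while dependence asks for it on one side and mere
-- connectivity on the other, so given connectivity on both sides the two are complementary. All
-- inductions run on derivations, because `component d s` is not a subterm of `⟨ s ⟩`.

-- Separates same-side from opposite-side rules: the latter hold their side condition as an
-- equation, which matching on indices alone does not refute.
opposite-irrefl : ∀ d → d ≢ opposite d
opposite-irrefl L ()
opposite-irrefl R ()

module _ {Name Key : Set} where
  open ProofLabels Name Key

  independent⇒connected : ∀ {θ₁ θ₂} → Independent θ₁ θ₂ → Connected θ₁ θ₂
  independent⇒connected (C1 i)    = C1 (independent⇒connected i)
  independent⇒connected (P1 i)    = P1 (independent⇒connected i)
  independent⇒connected (P2ₖ d _) = P2 d
  independent⇒connected (S1 i)    = S1 (independent⇒connected i)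
  independent⇒connected (S2 i)    = S2 (independent⇒connected i)
  independent⇒connected (S3 i j)  =
    S3 (independent⇒connected i) (independent⇒connected j)

  dependent⇒connected : ∀ {θ₁ θ₂} → Dependent θ₁ θ₂ → Connected θ₁ θ₂
  dependent⇒connected A1        = A1
  dependent⇒connected (A2 ¬p)   = A2 ¬p
  dependent⇒connected (C1 δ)    = C1 (dependent⇒connected δ)
  dependent⇒connected (C2 d)    = C2 d
  dependent⇒connected (P1 δ)    = P1 (dependent⇒connected δ)
  dependent⇒connected (P2ₖ d _) = P2 d
  dependent⇒connected (S1 δ)    = S1 (dependent⇒connected δ)
  dependent⇒connected (S2 δ)    = S2 (dependent⇒connected δ)
  dependent⇒connected (S3 L L L≢L _ _) = contradiction refl L≢L
  dependent⇒connected (S3 L R _ δ c)   = S3 (dependent⇒connected δ) c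
  dependent⇒connected (S3 R L _ δ c)   = S3 c (dependent⇒connected δ)
  dependent⇒connected (S3 R R R≢R _ _) = contradiction refl R≢R

  connected⇒independent⊎dependent : DecidableEquality Key → ∀ {θ₁ θ₂} →
    Connected θ₁ θ₂ → Independent θ₁ θ₂ ⊎ Dependent θ₁ θ₂
  connected⇒independent⊎dependent _≟_ = split
    where
    split : ∀ {θ₁ θ₂} → Connected θ₁ θ₂ → Independent θ₁ θ₂ ⊎ Dependent θ₁ θ₂
    split A1      = inj₂ A1
    split (A2 ¬p) = inj₂ (A2 ¬p)
    split (P1 c)  = map-⊎ P1 P1 (split c)
    -- The only place where keys are compared, and hence where decidable equality enters.
    split (P2 {θ = θ} {θ′} d) with key θ ≟ key θ′
    ... | yes k≡k′ = inj₂ (P2ₖ d k≡k′)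
    ... | no  k≢k′ = inj₁ (P2ₖ d k≢k′)
    split (C1 c)  = map-⊎ C1 C1 (split c)
    split (C2 d)  = inj₂ (C2 d)
    split (S1 c)  = map-⊎ S1 S1 (split c)
    split (S2 c)  = map-⊎ S2 S2 (split c)
    split (S3 cL cR) with split cL | split cR
    ... | inj₁ iL | inj₁ iR = inj₁ (S3 iL iR)
    -- One dependent side decides the matter; the original connectivity of the other side supplies
    -- the remaining premise.
    ... | inj₂ δL | _       = inj₂ (S3 L R (λ ()) δL cR)
    ... | inj₁ _  | inj₂ δR = inj₂ (S3 R L (λ ()) δR cL)

  -- No independence rule mentions a prefix, so `A1` and `A2` never arise. The surviving pairs of
  -- rules recurse, clash on direction, or clash on keys.
  independent-dependent-exclusive : ∀ {θ₁ θ₂} →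
    Independent θ₁ θ₂ → Dependent θ₁ θ₂ → ⊥
  independent-dependent-exclusive (C1 i) (C1 δ) = independent-dependent-exclusive i δ
  independent-dependent-exclusive (C1 _) (C2 d) = opposite-irrefl _ d
  independent-dependent-exclusive (P1 i) (P1 δ) = independent-dependent-exclusive i δ
  independent-dependent-exclusive (P1 _) (P2ₖ d _) = opposite-irrefl _ d
  independent-dependent-exclusive (P2ₖ d _) (P1 _) = opposite-irrefl _ d
  independent-dependent-exclusive (P2ₖ _ k≢k′) (P2ₖ _ k≡k′) = k≢k′ k≡k′
  independent-dependent-exclusive (S1 i) (S1 δ) = independent-dependent-exclusive i δ
  independent-dependent-exclusive (S2 i) (S2 δ) = independent-dependent-exclusive i δ
  -- Independence holds on both sides, so it contradicts dependence on whichever side `δ` lives.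
  independent-dependent-exclusive (S3 iL _) (S3 L _ _ δ _) =
    independent-dependent-exclusive iL δ
  independent-dependent-exclusive (S3 _ iR) (S3 R _ _ δ _) =
    independent-dependent-exclusive iR δ

theorem4p6 : (Name Key : Set) → Key ↔ ℕ →
    let open ProofLabels Name Key in
    (θ₁ θ₂ : ProofKeyedLabel) →
    (Independent θ₁ θ₂ → Connected θ₁ θ₂)
    × (Dependent θ₁ θ₂ → Connected θ₁ θ₂)
    × (Connected θ₁ θ₂ →
    (Independent θ₁ θ₂ ⊎ Dependent θ₁ θ₂)
    × ¬ (Independent θ₁ θ₂ × Dependent θ₁ θ₂))
theorem4p6 Name Key Key↔ℕ θ₁ θ₂ =
    independent⇒connected
  , dependent⇒connected
  -- Denumerability makes key equality decidable, by pulling equality back from `ℕ`.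
  , λ c → connected⇒independent⊎dependent (via-injection (↔⇒↣ Key↔ℕ) _≟ℕ_) c
        , uncurry independent-dependent-exclusive
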